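{- Let $k \ge 5$ be a natural number, and consider the problem GEP-UW on known undirected ladder graphs $G_{2,n}$, $n \ge 1$, with start vertex $s_0=(1,1)$ and with all edge weights in $\{1,k\}$. There exists a $4$-competitive deterministic online algorithm for this problem; that is, there exist a deterministic online algorithm $\textsc{alg}$ and a constant $\alpha\ge 0$ such that $\mathrm{cost}_{\textsc{alg}}(n,c) \le 4\cdot \mathrm{cost}_{\textsc{opt}}(n,c)+\alpha$ for every $n\ge 1$ and every weight function $c : E(G_{2,n}) \to \{1,k\}$.
   Context: For $m,n\ge 1$, the undirected $m\times n$ grid $G_{m,n}=(V,E)$ has $V=\{(i,j) : 1\le i\le m,\ 1\le j\le n\}$ and edges $\{(i,j),(i+1,j)\}$ for $1\le i\le m-1$, $1\le j\le n$, and $\{(i,j),(i,j+1)\}$ for $1\le i\le m$, $1\le j\le n-1$. The grids $G_{2,n}$ are called ladders. A path is a sequence of vertices in which consecutive vertices are adjacent; vertices (and edges) may be repeated. The cost of a path $v_1,\dots,v_\ell$ under a weight function $c$ is $\sum_{i=1}^{\ell-1} c(\{v_i,v_{i+1}\})$. GEP-UW (graph exploration problem in a known undirected graph structure with unknown edge weights): an agent starts in $s_0$ and must travel along a path that visits every vertex of the graph at least once (it need not return to $s_0$ and may end anywhere), minimizing the cost of the path. In each time step it moves from its current vertex to a neighboring vertex. The agent knows the unweighted graph, $s_0$ and the set of admissible weights from the beginning, but it does not know the weight function $c$. When it is in a vertex for the first time (in particular in $s_0$ at the beginning), the weights of all edges incident to that vertex are revealed. The agent has unlimited memory and computing power. A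 deterministic online algorithm determines each next move as a function of the information revealed so far (the graph, the path traveled so far, and the weights of all edges incident to visited vertices). $\mathrm{cost}_{\textsc{alg}}(n,c)$ is the cost of the path traveled by the agent under $\textsc{alg}$ on $G_{2,n}$ when the weight function is $c$, and $\mathrm{cost}_{\textsc{opt}}(n,c)$ is the minimum cost of a path in $G_{2,n}$ starting in $s_0$ that visits all vertices (computed with full knowledge of $c$). -}

module Defs where

open import Data.Fin using (Fin; zero; suc; inject₁)
open import Data.List using (List; []; _∷_)
open import Data.List.Membership.Propositional using (_∈_)
open import Data.Maybe using (Maybe; just; nothing)
open import Data.Nat using (ℕ; zero; suc; _+_; _*_; _≤_)
open import Data.Product using (Σ-syntax; ∃; ∃-syntax; _×_; _,_; proj₁; proj₂)
open import Data.Sum using (_⊎_)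
open import Relation.Binary.PropositionalEquality using (_≡_)

-- Coordinates are 0-based, so the pair (1,1) is (zero , zero).

Vertex : ℕ → ℕ → Set
Vertex m n = Fin m × Fin n

data Edge : ℕ → ℕ → Set where
  vertical   : ∀ {m n} → Fin m → Fin n → Edge (suc m) n
  horizontal : ∀ {m n} → Fin m → Fin n → Edge m (suc n)

-- The orientation of the pair is immaterial: edges are only used through
-- Joins and Incident, which are symmetric in the two endpoints.

endpoints : ∀ {m n} → Edge m n → Vertex m n × Vertex m n
endpoints (vertical i j)   = (inject₁ i , j) , (suc i , j)
endpoints (horizontal i j) = (i , inject₁ j) , (i , suc j)

Joins : ∀ {m n} → Edge m n → Vertex m n → Vertex m n → Set
Joins e u v = endpoints e ≡ (u , v) ⊎ endpoints e ≡ (v , u)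

Incident : ∀ {m n} → Edge m n → Vertex m n → Set
Incident e v = proj₁ (endpoints e) ≡ v ⊎ proj₂ (endpoints e) ≡ v

-- Two adjacent vertices are joined by exactly one edge.

Adjacent : ∀ {m n} → Vertex m n → Vertex m n → Set
Adjacent u v = ∃[ e ] Joins e u v

infixl 5 _▷_

data Path {m n} (s : Vertex m n) : Vertex m n → Set where
  []  : Path s s
  _▷_ : ∀ {u v} → Path s u → Adjacent u v → Path s v

visited : ∀ {m n} {s v : Vertex m n} → Path s v → List (Vertex m n)
visited {v = v} []      = v ∷ []
visited {v = v} (p ▷ _) = v ∷ visited p

Explores : ∀ {m n} {s v : Vertex m n} → Path s v → Set
Explores p = ∀ w → w ∈ visited p

Weight : ℕ → Set
Weight k = Σ[ w ∈ ℕ ] (w ≡ 1 ⊎ w ≡ k)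

WeightFunction : ℕ → ℕ → ℕ → Set
WeightFunction k m n = Edge m n → Weight k

cost : ∀ {k m n} {s v : Vertex m n} → WeightFunction k m n → Path s v → ℕ
cost c []            = 0
cost c (p ▷ (e , _)) = cost c p + proj₁ (c e)

Revealed : ∀ {m n} {s v : Vertex m n} → Path s v → Edge m n → Set
Revealed p e = ∃[ u ] (u ∈ visited p × Incident e u)

Observation : ∀ {m n} {s v : Vertex m n} → ℕ → Path s v → Set
Observation k p = ∀ e → Revealed p e → Weight k

observe : ∀ {k m n} {s v : Vertex m n} →
          WeightFunction k m n → (p : Path s v) → Observation k p
observe c p e _ = c e

-- G_{2,n} with n ≥ 1 is represented by the index n - 1, so that
-- quantifying over all natural indices ranges over all ladders.

LadderVertex : ℕ → Set
LadderVertex n = Vertex 2 (suc n)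

s₀ : ∀ {n} → LadderVertex n
s₀ = zero , zero

LadderPath : ∀ n → LadderVertex n → Set
LadderPath n v = Path s₀ v

LadderWeights : ℕ → ℕ → Set
LadderWeights k n = WeightFunction k 2 (suc n)

-- The answer nothing means that the agent stops.

OnlineAlgorithm : ℕ → Set
OnlineAlgorithm k =
  ∀ n {v} (p : LadderPath n v) → Observation k p → Maybe (∃[ w ] Adjacent v w)

data Travels {k n} (alg : OnlineAlgorithm k) (c : LadderWeights k n) :
             ∀ {v} → LadderPath n v → Set where
  start : Travels alg c []
  move  : ∀ {u v} {p : LadderPath n u} {a : Adjacent u v} →
          Travels alg c p → alg n p (observe c p) ≡ just (v , a) →
          Travels alg c (p ▷ a)

-- cost_alg and cost_opt are given by their graphs: CostAlg alg n c x says
-- that alg stops after exploring the whole ladder at total cost x, and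
-- CostOpt n c y says that y is the minimum cost of an exploring path.

CostAlg : ∀ {k} → OnlineAlgorithm k → ∀ n → LadderWeights k n → ℕ → Set
CostAlg alg n c x =
  ∃[ v ] Σ[ p ∈ LadderPath n v ]
    (Travels alg c p × alg n p (observe c p) ≡ nothing × Explores p × cost c p ≡ x)

CostOpt : ∀ {k} n → LadderWeights k n → ℕ → Set
CostOpt n c y =
  (∃[ v ] Σ[ p ∈ LadderPath n v ] (Explores p × cost c p ≡ y)) ×
  (∀ {v} (p : LadderPath n v) → Explores p → y ≤ cost c p)

-- A natural additive constant loses nothing, since all costs are natural.

Competitive : ∀ {k} → ℕ → OnlineAlgorithm k → Set
Competitive {k} ρ alg =
  ∃[ α ] (∀ n (c : LadderWeights k n) →
    ∃[ x ] ∃[ y ] (CostAlg alg n c x × CostOpt n c y × x ≤ ρ * y + α))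

-- In every grid, the agent explores each light component (with respect to the
-- edges of weight 1) by a depth-first search along light edges only. It then
-- traverses the resulting spanning tree a second time; from each vertex it
-- crosses to every neighbour that is still unseen, treats the component of that
-- neighbour recursively, and comes back. Since explored components are closed
-- under light edges, each crossing is heavy and reaches a new component. So tree
-- edges are used four times and each of the C - 1 crossings twice, at a cost of
-- 4 (N - C) + 2k (C - 1) for N vertices and C light components, while every
-- exploring path costs at least (N - C) + k (C - 1), the weight of a minimum
-- spanning tree.

module Submission where

open import Data.Bool using (if_then_else_)
open import Data.Empty using (⊥-elim)
open import Data.Fin using (Fin; zero; suc)
import Data.Fin.Properties as Fin
open import Data.Fin.Induction using (<-weakInduction)
open import Data.List using (List; []; _∷_; _++_; map; length; concatMap; filter; upTo; allFin;
  cartesianProduct; cartesianProductWith)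
open import Data.List.Extrema.Nat using (argmin; argmin-all; f[argmin]≤f[⊤]; f[argmin]≤f[xs])
open import Data.List.Membership.Propositional using (_∈_; _∉_; lose)
open import Data.List.Membership.Propositional.Properties
import Data.List.Membership.DecPropositional as DecMembership
open import Data.List.Properties using (length-removeAt′)
open import Data.List.Relation.Binary.Subset.Propositional using (_⊆_)
open import Data.List.Relation.Unary.All as All using (All; []; _∷_)
import Data.List.Relation.Unary.All.Properties as All
open import Data.List.Relation.Unary.AllPairs as AllPairs using (AllPairs; []; _∷_)
open import Data.List.Relation.Unary.Any as Any using (Any; here; there; _─_)
open import Data.List.Relation.Unary.Unique.Propositional using (Unique)
open import Data.Maybe using (Maybe; just; nothing; _>>=_)
open import Data.Nat using (ℕ; zero; suc; _+_; _*_; _≤_; z≤n; s≤s; _≟_; _≤?_)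
open import Data.Nat.Properties hiding (_≟_; _≤?_)
open import Data.Nat.Tactic.RingSolver using (solve-∀)
open import Data.Product using (Σ-syntax; ∃; ∃-syntax; _×_; _,_; proj₁; proj₂)
open import Data.Product.Properties using (≡-dec)
open import Data.Sum using (_⊎_; inj₁; inj₂; [_,_]′; swap)
open import Data.Unit using (⊤; tt)
open import Function using (_∘_; id)
open import Relation.Binary using (DecidableEquality; Symmetric)
open import Relation.Binary.Construct.Closure.ReflexiveTransitive using (Star; ε; _◅_; _◅◅_; reverse)
open import Relation.Binary.PropositionalEquality
open import Relation.Nullary using (¬_; Dec; does; yes; no; ¬?; contradiction)
open import Relation.Nullary.Decidable using (decidable-stable; map′; _×-dec_)
open import Defs

-- Pigeonhole counting on lists.

module _ {A B : Set} {R : A → B → Set} where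

  ─-keeps : ∀ {x x′ ys} (x∈ : Any (R x) ys) → (∀ y → R x y → ¬ R x′ y) →
            Any (R x′) ys → Any (R x′) (ys ─ x∈)
  ─-keeps (here r)   apart (here r′)   = ⊥-elim (apart _ r r′)
  ─-keeps (here r)   apart (there x′∈) = x′∈
  ─-keeps (there x∈) apart (here r′)   = here r′
  ─-keeps (there x∈) apart (there x′∈) = there (─-keeps x∈ apart x′∈)

  -- No two entries of `xs` can share a partner, so deleting the partner of the first entry leaves
  -- those of the others intact. `R` is general because it is used both with equality, to count
  -- vertices, and with connectedness, to count light components.
  pigeonhole : ∀ {xs ys} → AllPairs (λ x x′ → ∀ y → R x y → ¬ R x′ y) xs →
               All (λ x → Any (R x) ys) xs → length xs ≤ length ys
  pigeonhole []               []           = z≤n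
  pigeonhole {ys = ys} (apart ∷ aparts) (x∈ ∷ xs∈) =
    subst (_ ≤_) (sym (length-removeAt′ ys (Any.index x∈)))
      (s≤s (pigeonhole aparts (All.zipWith (λ (a , x′∈) → ─-keeps x∈ a x′∈) (apart , xs∈))))

unique-⊆⇒length≤ : ∀ {A : Set} {xs ys : List A} → Unique xs → xs ⊆ ys → length xs ≤ length ys
unique-⊆⇒length≤ unique xs⊆ys =
  pigeonhole {R = _≡_} (AllPairs.map (λ x≢x′ _ p q → x≢x′ (trans p (sym q))) unique) (All.tabulate xs⊆ys)

-- Enumeration of vertices, edges and moves in a grid.

module _ {m n : ℕ} where

  infix 4 _≟ᵛ_ _∈?_

  _≟ᵛ_ : DecidableEquality (Vertex m n)
  _≟ᵛ_ = ≡-dec Fin._≟_ Fin._≟_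

  _∈?_ : (v : Vertex m n) (vs : List (Vertex m n)) → Dec (v ∈ vs)
  _∈?_ = DecMembership._∈?_ _≟ᵛ_

  vertices : List (Vertex m n)
  vertices = cartesianProduct (allFin m) (allFin n)

  ∈-vertices : ∀ v → v ∈ vertices
  ∈-vertices (i , j) = ∈-cartesianProduct⁺ (∈-allFin i) (∈-allFin j)

verticals : ∀ m n → List (Edge m n)
verticals zero    n = []
verticals (suc m) n = cartesianProductWith vertical (allFin m) (allFin n)

horizontals : ∀ m n → List (Edge m n)
horizontals m zero    = []
horizontals m (suc n) = cartesianProductWith horizontal (allFin m) (allFin n)

edges : ∀ {m n} → List (Edge m n)
edges {m} {n} = verticals m n ++ horizontals m n

∈-edges : ∀ {m n} (e : Edge m n) → e ∈ edges
∈-edges (vertical i j) =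
  ∈-++⁺ˡ (∈-cartesianProductWith⁺ vertical (∈-allFin i) (∈-allFin j))
∈-edges {m} {n} (horizontal i j) =
  ∈-++⁺ʳ (verticals m n) (∈-cartesianProductWith⁺ horizontal (∈-allFin i) (∈-allFin j))

module _ {m n : ℕ} where

  Move : Vertex m n → Set
  Move v = ∃[ w ] Adjacent v w

  back : ∀ {u v : Vertex m n} → Adjacent u v → Adjacent v u
  back (e , joins) = e , swap joins

  along against : (e : Edge m n) (v : Vertex m n) → List (Move v)
  along e v with proj₁ (endpoints e) ≟ᵛ v
  ... | yes refl = (proj₂ (endpoints e) , e , inj₁ refl) ∷ []
  ... | no _     = []
  against e v with proj₂ (endpoints e) ≟ᵛ v
  ... | yes refl = (proj₁ (endpoints e) , e , inj₂ refl) ∷ []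
  ... | no _     = []

  moves : (v : Vertex m n) → List (Move v)
  moves v = concatMap (λ e → along e v ++ against e v) edges

  ∈-along : ∀ e {v w : Vertex m n} (eq : endpoints e ≡ (v , w)) → (w , e , inj₁ eq) ∈ along e v
  -- The rewrite decides the comparison inside `along` as `yes refl`, so the listed move carries the
  -- very proof `inj₁ refl`.
  ∈-along e refl rewrite ≡-≟-identity _≟ᵛ_ {x = proj₁ (endpoints e)} refl = here refl

  ∈-against : ∀ e {v w : Vertex m n} (eq : endpoints e ≡ (w , v)) → (w , e , inj₂ eq) ∈ against e v
  ∈-against e refl rewrite ≡-≟-identity _≟ᵛ_ {x = proj₂ (endpoints e)} refl = here refl

  ∈-moves : ∀ {v w : Vertex m n} (a : Adjacent v w) → (w , a) ∈ moves v
  ∈-moves {v} (e , joins) = ∈-concatMap⁺ _ (lose (∈-edges e) (member joins))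
    where
    member : ∀ {w} (joins : Joins e v w) → (w , e , joins) ∈ along e v ++ against e v
    member (inj₁ eq) = ∈-++⁺ˡ (∈-along e eq)
    member (inj₂ eq) = ∈-++⁺ʳ (along e v) (∈-against e eq)

-- The two-pass exploration as an interactive program.

module Exploration (k : ℕ) {m n : ℕ} where

  private
    V = Vertex m n
    variable
      A B : Set
      u v w : V

  Reading : V → Set
  Reading v = ∀ e → Incident e v → Weight k

  -- A decision tree indexed by the start and end positions of the agent. Weights enter only as
  -- readings at vertices just reached, so every program is online by construction.
  data Program (A : Set) : V → V → Set where
    return : A → Program A v v
    go     : Adjacent u v → (Reading v → Program A v w) → Program A u w

  bind : Program A u v → (A → Program B v w) → Program B u w
  bind (return x) f = f x
  bind (go a P)   f = go a λ l → bind (P l) f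

  detour : Adjacent v w → (Reading w → Program A w w) → (A → Program B v u) → Program B v u
  detour a P f = go a λ l → bind (P l) λ x → go (back a) λ _ → f x

  -- Spanning trees of light components: Forest v lists the subtrees hanging
  -- below v as (first subtree, remaining subtrees).
  data Forest (v : V) : Set where
    []     : Forest v
    branch : Adjacent v w → Forest w → Forest v → Forest v

  size : Forest v → ℕ
  size []             = 0
  size (branch _ f h) = suc (size f + size h)

  grow : Forest v → List V → List V
  grow []                   xs = xs
  grow (branch {w = w} _ f h) xs = grow h (grow f (w ∷ xs))

  Component : Set
  Component = Σ[ r ∈ V ] Forest r

  seen : List Component → List V
  seen []             = []
  seen ((r , f) ∷ cs) = grow f (r ∷ seen cs)

  roots : List Component → List V
  roots = map proj₁

  -- 2k pays for crossing to a new component and back, and 4 for traversing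
  -- a light tree edge back and forth in both passes.
  budget : List Component → ℕ
  budget []             = 0
  budget ((r , f) ∷ cs) = 2 * k + 4 * size f + budget cs

  sourceIncident : (a : Adjacent v w) → Incident (proj₁ a) v
  sourceIncident (e , inj₁ eq) = inj₁ (cong proj₁ eq)
  sourceIncident (e , inj₂ eq) = inj₂ (cong proj₂ eq)

  LightAt : Reading v → Adjacent v w → Set
  LightAt l a = proj₁ (l (proj₁ a) (sourceIncident a)) ≡ 1

  lightNew? : (l : Reading v) (a : Adjacent v w) (xs : List V) → Dec (LightAt l a × w ∉ xs)
  lightNew? {w = w} l a xs = (_ ≟ 1) ×-dec ¬? (w ∈? xs)

  -- The first argument of the recursive programs is fuel; it only has to
  -- bound the number of unseen vertices.
  lightForest : ℕ → List V → Reading v → List (Move v) → Program (Forest v) v v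
  lightForest zero    xs l ms       = return []
  lightForest (suc g) xs l []       = return []
  lightForest (suc g) xs l ((w , a) ∷ ms) =
    if does (lightNew? l a xs)
    then (detour a (λ l′ → lightForest g (w ∷ xs) l′ (moves w)) λ f →
          bind (lightForest (suc g) (grow f (w ∷ xs)) l ms) λ h →
          return (branch a f h))
    else lightForest (suc g) xs l ms

  -- The second pass, as a mutual recursion. Fuel drops only when `cross` enters a new component;
  -- otherwise the list of moves or the forest shrinks.
  cross : ℕ → List Component → List (Move v) → Program (List Component) v v
  visit : ℕ → List Component → Forest v → Program (List Component) v v
  sweep : ℕ → List Component → Forest v → Program (List Component) v v

  cross zero    cs ms = return cs
  cross (suc g) cs [] = return cs
  cross (suc g) cs ((w , a) ∷ ms) =
    if does (w ∈? seen cs)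
    then cross (suc g) cs ms
    else detour a (λ l → bind (lightForest g (w ∷ seen cs) l (moves w)) λ f →
                         visit g ((w , f) ∷ cs) f)
                  (λ cs′ → cross (suc g) cs′ ms)

  visit {v} g cs f = bind (cross g cs (moves v)) λ cs′ → sweep g cs′ f

  sweep g cs []             = return cs
  sweep g cs (branch a f h) = detour a (λ _ → visit g cs f) λ cs′ → sweep g cs′ h

  explore : Reading v → Program (List Component) v v
  explore {v} l = bind (lightForest (length (vertices {m} {n})) (v ∷ []) l (moves v)) λ f →
                  visit (length (vertices {m} {n})) ((v , f) ∷ []) f

  -- Program logic for runs under fixed weights.

  module Correctness (c : WeightFunction k m n) (s : V) where

    -- Weakest precondition: with the weights fixed, a program has a single run from the end of `p`,
    -- and the postcondition is demanded of its result and final path.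
    wp : Program A u v → (A → Path s v → Set) → Path s u → Set
    wp (return x) Q p = Q x p
    wp (go a P)   Q p = wp (P λ e _ → c e) Q (p ▷ a)

    wp-bind : (P : Program A u v) {f : A → Program B v w} {Q : A → Path s v → Set}
              {R : B → Path s w → Set} {p : Path s u} →
              wp P Q p → (∀ x q → Q x q → wp (f x) R q) → wp (bind P f) R p
    wp-bind (return x) Qp h = h x _ Qp
    wp-bind (go a P)   wpP h = wp-bind (P λ e _ → c e) wpP h

    wp-map : (P : Program A u v) {Q R : A → Path s v → Set} {p : Path s u} →
             wp P Q p → (∀ x q → Q x q → R x q) → wp P R p
    wp-map (return x) Qp  h = h x _ Qp
    wp-map (go a P)   wpP h = wp-map (P λ e _ → c e) wpP h

    wp-if : {X : Set} (X? : Dec X) {P P′ : Program A u v} {Q : A → Path s v → Set} {p : Path s u} →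
            (X → wp P Q p) → (¬ X → wp P′ Q p) → wp (if does X? then P else P′) Q p
    wp-if (yes x) h h′ = h x
    wp-if (no ¬x) h h′ = h′ ¬x

    Light : Edge m n → Set
    Light e = proj₁ (c e) ≡ 1

    Linked : V → V → Set
    Linked u v = ∃[ e ] (Joins e u v × Light e)

    LightClosed NbrClosed : V → List V → Set
    LightClosed x xs = ∀ y → Linked x y → y ∈ xs
    NbrClosed   x xs = ∀ y → Adjacent x y → y ∈ xs

    AllLight : Forest v → Set
    AllLight []             = ⊤
    AllLight (branch a f h) = Light (proj₁ a) × AllLight f × AllLight h

    grow-⊇ : (f : Forest v) {xs : List V} → xs ⊆ grow f xs
    grow-⊇ []             x∈ = x∈
    grow-⊇ (branch a f h) x∈ = grow-⊇ h (grow-⊇ f (there x∈))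

    length-grow : (f : Forest v) (xs : List V) → length (grow f xs) ≡ size f + length xs
    length-grow []             xs = refl
    length-grow (branch {w = w} a f h) xs = begin
      length (grow h (grow f (w ∷ xs)))      ≡⟨ length-grow h _ ⟩
      size h + length (grow f (w ∷ xs))      ≡⟨ cong (size h +_) (length-grow f _) ⟩
      size h + (size f + suc (length xs))    ≡⟨ regroup (size f) (size h) (length xs) ⟩
      suc (size f + size h) + length xs      ∎
      where
      open ≡-Reasoning
      regroup : ∀ a b x → b + (a + suc x) ≡ suc (a + b) + x
      regroup = solve-∀

    -- First pass: fuel and light spanning trees.

    record Found (xs : List V) (p : Path s v) : Set where
      constructor _,_
      field
        unique : Unique xs
        onPath : xs ⊆ visited p
    open Found

    found-▷ : ∀ {xs} {p : Path s v} (a : Adjacent v w) → Found xs p → Found xs (p ▷ a)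
    found-▷ a (unique , onPath) = unique , there ∘ onPath

    found-new : ∀ {xs} {p : Path s v} (a : Adjacent v w) → w ∉ xs → Found xs p → Found (w ∷ xs) (p ▷ a)
    found-new {xs = xs} a w∉ (unique , onPath) =
      (All.¬Any⇒All¬ xs w∉ ∷ unique) ,
      λ { (here eq) → here eq ; (there x∈) → there (onPath x∈) }

    -- For duplicate-free `xs`, at most `g` vertices are missing, phrased without subtraction.
    Enough : ℕ → List V → Set
    Enough g xs = length (vertices {m} {n}) ≤ length xs + g

    enough-mono : ∀ {g xs ys} → Unique xs → xs ⊆ ys → Enough g xs → Enough g ys
    enough-mono {g} unique xs⊆ys enough = ≤-trans enough (+-monoˡ-≤ g (unique-⊆⇒length≤ unique xs⊆ys))

    enough-new : ∀ {g w xs} → Enough (suc g) xs → Enough g (w ∷ xs)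
    enough-new {g} {_} {xs} = subst (length (vertices {m} {n}) ≤_) (+-suc (length xs) g)

    -- A missing vertex would extend `xs` to a duplicate-free list longer than the list of all
    -- vertices. Hence stopping at fuel zero overlooks nothing.
    outOfFuel : ∀ {xs} → Unique xs → Enough 0 xs → ∀ w → w ∈ xs
    outOfFuel {xs} unique enough w with w ∈? xs
    ... | yes w∈ = w∈
    ... | no w∉  = contradiction
      (≤-trans (unique-⊆⇒length≤ {xs = w ∷ xs}
                 (All.¬Any⇒All¬ xs w∉ ∷ unique)
                 (λ {x} _ → ∈-vertices x))
               (subst (_ ≤_) (+-identityʳ _) enough))
      (<-irrefl refl)

    -- Invariant for a search at `v` with the moves `ms` still to be tried. Vertices already in `xs`
    -- may have light edges pending, so `closed` claims closure for new vertices only, while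
    -- `targets` accounts for the edges in `ms`. Each light tree edge costs 2.
    record Grown {v} (xs : List V) (ms : List (Move v)) (p : Path s v)
                 (f : Forest v) (q : Path s v) : Set where
      field
        found   : Found (grow f xs) q
        cost≡   : cost c q ≡ cost c p + 2 * size f
        light   : AllLight f
        targets : ∀ {y} {a : Adjacent v y} → (y , a) ∈ ms → Light (proj₁ a) → y ∈ grow f xs
        closed  : ∀ {x} → x ∈ grow f xs → x ∈ xs ⊎ LightClosed x (grow f xs)

    -- Once all of `moves v` have been tried, `targets` yields closure for the root `v` as well.
    grown-closed : ∀ {xs} {p q : Path s v} {f} → Grown (v ∷ xs) (moves v) p f q →
                   ∀ {x} → x ∈ grow f (v ∷ xs) → x ∈ xs ⊎ LightClosed x (grow f (v ∷ xs))
    grown-closed grown x∈ with Grown.closed grown x∈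
    ... | inj₁ (here refl) = inj₂ λ _ (e , joins , light) → Grown.targets grown (∈-moves (e , joins)) light
    ... | inj₁ (there x∈xs) = inj₁ x∈xs
    ... | inj₂ closed = inj₂ closed

    lightForest-grown : ∀ g {xs} (ms : List (Move v)) {p : Path s v} → Found xs p → Enough g xs →
      wp (lightForest g xs (λ e _ → c e) ms) (Grown xs ms p) p
    lightForest-grown zero ms found enough = record
      { found = found ; cost≡ = sym (+-identityʳ _) ; light = tt
      ; targets = λ _ _ → outOfFuel (unique found) enough _ ; closed = inj₁ }
    lightForest-grown (suc g) [] found enough = record
      { found = found ; cost≡ = sym (+-identityʳ _) ; light = tt
      ; targets = λ () ; closed = inj₁ }
    lightForest-grown {v} (suc g) {xs} ((w , a) ∷ ms) {p} found enough =
      wp-if (lightNew? {v = v} (λ e _ → c e) a xs)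
      (λ (lightA , w∉) →
        wp-bind (lightForest g (w ∷ xs) _ (moves w))
          (lightForest-grown g (moves w) (found-new a w∉ found) (enough-new {w = w} {xs = xs} enough))
          λ f q first →
        wp-bind (lightForest (suc g) (grow f (w ∷ xs)) _ ms)
          (lightForest-grown (suc g) ms (found-▷ (back a) (Grown.found first))
            (enough-mono (unique found) (grow-⊇ f ∘ there) enough))
          λ h q′ rest → combine lightA first rest)
      (λ ¬new →
        wp-map (lightForest (suc g) xs _ ms) (lightForest-grown (suc g) ms found enough)
          λ f q grown → record
            { found = Grown.found grown ; cost≡ = Grown.cost≡ grown ; light = Grown.light grown
            -- A light edge that was not taken leads into `xs`; since membership is decidable, it
            -- follows from its double negation.
            ; targets = λ { (here refl) light → grow-⊇ f (decidable-stable (w ∈? xs) λ w∉ → ¬new (light , w∉))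
                          ; (there a∈) → Grown.targets grown a∈ }
            ; closed = Grown.closed grown })
      where
      combine : ∀ {f q h q′} → Light (proj₁ a) → Grown (w ∷ xs) (moves w) (p ▷ a) f q →
                Grown (grow f (w ∷ xs)) ms (q ▷ back a) h q′ →
                Grown xs ((w , a) ∷ ms) p (branch a f h) q′
      combine {f} {q} {h} {q′} lightA first rest = record
        { found = Grown.found rest
        ; cost≡ = begin
            cost c q′ ≡⟨ Grown.cost≡ rest ⟩
            cost c q + proj₁ (c (proj₁ a)) + 2 * size h
              ≡⟨ cong₂ (λ x y → x + y + 2 * size h) (Grown.cost≡ first) lightA ⟩
            cost c p + proj₁ (c (proj₁ a)) + 2 * size f + 1 + 2 * size h
              ≡⟨ cong (λ x → cost c p + x + 2 * size f + 1 + 2 * size h) lightA ⟩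
            cost c p + 1 + 2 * size f + 1 + 2 * size h
              ≡⟨ regroup (cost c p) (size f) (size h) ⟩
            cost c p + 2 * suc (size f + size h) ∎
        ; light = lightA , Grown.light first , Grown.light rest
        ; targets = λ { (here refl) _ → grow-⊇ h (grow-⊇ f (here refl))
                      ; (there a∈) → Grown.targets rest a∈ }
        ; closed = closed }
        where
        open ≡-Reasoning
        regroup : ∀ x a b → x + 1 + 2 * a + 1 + 2 * b ≡ x + 2 * suc (a + b)
        regroup = solve-∀
        closed : ∀ {x} → x ∈ grow h (grow f (w ∷ xs)) →
                 x ∈ xs ⊎ LightClosed x (grow h (grow f (w ∷ xs)))
        closed x∈ with Grown.closed rest x∈
        ... | inj₂ closed = inj₂ closed
        ... | inj₁ x∈f with grown-closed first x∈f
        ...   | inj₁ x∈xs   = inj₁ x∈xs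
        ...   | inj₂ closed = inj₂ λ y link → grow-⊇ h (closed y link)

    -- Second pass: light components and amortised cost.

    Connected : V → V → Set
    Connected = Star Linked

    connected-sym : Symmetric Connected
    connected-sym = reverse λ (e , joins , light) → e , swap joins , light

    record Explored (cs : List Component) (p : Path s v) : Set where
      field
        found  : Found (seen cs) p
        closed : ∀ {x} → x ∈ seen cs → LightClosed x (seen cs)
        apart  : AllPairs (λ r r′ → ¬ Connected r r′) (roots cs)

    -- `seen cs` is closed under light edges, so no light path leaves it.
    connected-seen : ∀ {cs} {p : Path s v} → Explored cs p →
                     ∀ {x y} → Connected x y → x ∈ seen cs → y ∈ seen cs
    connected-seen explored ε           x∈ = x∈
    connected-seen explored (link ◅ xy) x∈ =
      connected-seen explored xy (Explored.closed explored x∈ _ link)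

    roots-seen : ∀ {cs} → All (_∈ seen cs) (roots cs)
    roots-seen {[]}           = []
    roots-seen {(r , f) ∷ cs} = grow-⊇ f (here refl) ∷ All.map (grow-⊇ f ∘ there) (roots-seen {cs})

    explored-▷ : ∀ {cs} {p : Path s v} (a : Adjacent v w) → Explored cs p → Explored cs (p ▷ a)
    explored-▷ a explored = record
      { found = found-▷ a found ; closed = closed ; apart = apart }
      where open Explored explored

    explored-new : ∀ {cs xs} {p : Path s v} {q : Path s w} {f} → Explored cs p → w ∉ seen cs →
                   Grown (w ∷ seen cs) (moves w) q f xs → Explored ((w , f) ∷ cs) xs
    explored-new {cs = cs} {f = f} explored w∉ grown = record
      { found  = Grown.found grown
      ; closed = λ x∈ → [ (λ x∈cs y link → grow-⊇ f (there (Explored.closed explored x∈cs y link)))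
                        , id ]′ (grown-closed grown x∈)
      -- A light path from `w` to an earlier root, read backwards, would put `w` among the seen
      -- vertices.
      ; apart  = All.map (λ r∈ wr → w∉ (connected-seen explored (connected-sym wr) r∈)) (roots-seen {cs})
                 ∷ Explored.apart explored }

    -- Amortised accounting without subtraction: the cost from `p` to `q` is the growth of the
    -- budget, charged to new components, plus `d` for light tree edges of components known before.
    record Progress (d : ℕ) (cs : List Component) (p : Path s u)
                    (cs′ : List Component) (q : Path s v) : Set where
      field
        explored : Explored cs′ q
        seen-⊆   : seen cs ⊆ seen cs′
        cost≡    : cost c q + budget cs ≡ cost c p + d + budget cs′
        finished : ∀ {x} → x ∈ seen cs′ → x ∈ seen cs ⊎ NbrClosed x (seen cs′)

    progress-refl : ∀ {cs} {p : Path s v} → Explored cs p → Progress 0 cs p cs p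
    progress-refl {cs = cs} explored = record
      { explored = explored ; seen-⊆ = id ; cost≡ = cong (_+ budget cs) (sym (+-identityʳ _))
      ; finished = inj₁ }

    progress-▷ : ∀ {d cs cs′} {p : Path s u} {q : Path s v} (a : Adjacent v w) → Light (proj₁ a) →
                 Progress d cs p cs′ q → Progress (suc d) cs p cs′ (q ▷ a)
    progress-▷ {d = d} {cs} {cs′} {p} {q} a lightA progress = record
      { explored = explored-▷ a explored ; seen-⊆ = seen-⊆ ; finished = finished
      ; cost≡ = begin
          cost c q + proj₁ (c (proj₁ a)) + budget cs  ≡⟨ cong (λ x → cost c q + x + budget cs) lightA ⟩
          cost c q + 1 + budget cs                    ≡⟨ regroup (cost c q) (budget cs) ⟩
          suc (cost c q + budget cs)                  ≡⟨ cong suc cost≡ ⟩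
          suc (cost c p + d + budget cs′)             ≡⟨ cong (_+ budget cs′) (sym (+-suc (cost c p) d)) ⟩
          cost c p + suc d + budget cs′               ∎ }
      where
      open Progress progress
      open ≡-Reasoning
      regroup : ∀ x b → x + 1 + b ≡ suc (x + b)
      regroup = solve-∀

    nbrClosed-mono : ∀ {x xs ys} → xs ⊆ ys → NbrClosed x xs → NbrClosed x ys
    nbrClosed-mono xs⊆ys closed y a = xs⊆ys (closed y a)

    progress-trans : ∀ {d d′ cs₀ cs₁ cs₂} {p : Path s u} {q : Path s v} {r : Path s w} →
                     Progress d cs₀ p cs₁ q → Progress d′ cs₁ q cs₂ r →
                     Progress (d + d′) cs₀ p cs₂ r
    progress-trans {d = d} {d′} {cs₀} {cs₁} {cs₂} {p} {q} {r} first rest = record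
      { explored = Progress.explored rest
      ; seen-⊆   = Progress.seen-⊆ rest ∘ Progress.seen-⊆ first
      ; cost≡    = telescope {cost c p} (Progress.cost≡ first) (Progress.cost≡ rest)
      ; finished = λ x∈ → [ [ inj₁ , inj₂ ∘ nbrClosed-mono (Progress.seen-⊆ rest) ]′ ∘ Progress.finished first
                          , inj₂ ]′ (Progress.finished rest x∈) }
      where
      telescope : ∀ {x y z b₀ b₁ b₂ d d′} → y + b₀ ≡ x + d + b₁ → z + b₁ ≡ y + d′ + b₂ →
                  z + b₀ ≡ x + (d + d′) + b₂
      telescope {x} {y} {z} {b₀} {b₁} {b₂} {d} {d′} eq eq′ = +-cancelʳ-≡ b₁ _ _ (begin
        z + b₀ + b₁              ≡⟨ regroup₁ z b₀ b₁ ⟩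
        (z + b₁) + b₀            ≡⟨ cong (_+ b₀) eq′ ⟩
        y + d′ + b₂ + b₀         ≡⟨ regroup₂ y d′ b₂ b₀ ⟩
        (y + b₀) + (d′ + b₂)     ≡⟨ cong (_+ (d′ + b₂)) eq ⟩
        x + d + b₁ + (d′ + b₂)   ≡⟨ regroup₃ x d b₁ d′ b₂ ⟩
        x + (d + d′) + b₂ + b₁   ∎)
        where
        open ≡-Reasoning
        regroup₁ : ∀ a b c → a + b + c ≡ (a + c) + b
        regroup₁ = solve-∀
        regroup₂ : ∀ a b c d → a + b + c + d ≡ (a + d) + (b + c)
        regroup₂ = solve-∀
        regroup₃ : ∀ a b c d e → a + b + c + (d + e) ≡ a + (b + d) + e + c
        regroup₃ = solve-∀

    -- Quantifying over the accumulator `xs` singles out the vertices of the forest itself: each has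
    -- all its neighbours in `ys`. The root `v` is left out and handled by `Visited`.
    Covers : Forest v → List V → Set
    Covers f ys = ∀ {xs x} → x ∈ grow f xs → x ∈ xs ⊎ NbrClosed x ys

    Crossed : List Component → List (Move v) → Path s v → List Component → Path s v → Set
    Crossed cs ms p cs′ q =
      Progress 0 cs p cs′ q × (∀ {y a} → (y , a) ∈ ms → y ∈ seen cs′)

    Swept Visited : List Component → Forest v → Path s v → List Component → Path s v → Set
    Swept cs f p cs′ q = Progress (2 * size f) cs p cs′ q × Covers f (seen cs′)
    Visited {v} cs f p cs′ q = Swept cs f p cs′ q × NbrClosed v (seen cs′)

    enough-explored : ∀ {g cs cs′} {p : Path s v} → Explored cs p → seen cs ⊆ seen cs′ →
                      Enough g (seen cs) → Enough g (seen cs′)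
    enough-explored explored = enough-mono (unique (Explored.found explored))

    -- The edge is heavy because it leaves a set closed under light edges. The crossing, the two
    -- passes through the new tree and the return cost `k + 2 * size f + 2 * size f + k`, exactly
    -- the budget entry of the new component, so nothing is charged to the old ones.
    cross-new : ∀ {cs ms p f q cs′ r} {a : Adjacent v w} → Explored cs p → v ∈ seen cs → w ∉ seen cs →
                Grown (w ∷ seen cs) (moves w) (p ▷ a) f q → Visited ((w , f) ∷ cs) f q cs′ r →
                ∀ {cs″ r′} → Crossed cs′ ms (r ▷ back a) cs″ r′ → Crossed cs ((w , a) ∷ ms) p cs″ r′
    cross-new {v} {w} {cs} {ms} {p} {f} {q} {cs′} {r} {a} explored v∈ w∉ grown
              ((progress , covers) , w-closed) (rest , targets) =
      progress-trans new rest ,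
      λ { (here refl) → Progress.seen-⊆ rest (Progress.seen-⊆ progress (grow-⊇ f (here refl)))
        ; (there a∈)  → targets a∈ }
      where
      heavy : proj₁ (c (proj₁ a)) ≡ k
      heavy with proj₂ (c (proj₁ a))
      ... | inj₁ light = contradiction (Explored.closed explored v∈ w (proj₁ a , proj₂ a , light)) w∉
      ... | inj₂ heavy = heavy

      pay : ∀ {x y z b b′} s → y ≡ x + k + 2 * s → z + (2 * k + 4 * s + b) ≡ y + 2 * s + b′ →
            z + k + b ≡ x + 0 + b′
      pay {x} {y} {z} {b} {b′} s refl eq = +-cancelʳ-≡ (k + 4 * s) _ _
        (trans (regroup₁ z k b s) (trans eq (regroup₂ x k s b′)))
        where
        regroup₁ : ∀ z k b s → z + k + b + (k + 4 * s) ≡ z + (2 * k + 4 * s + b)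
        regroup₁ = solve-∀
        regroup₂ : ∀ x k s b → x + k + 2 * s + 2 * s + b ≡ x + 0 + b + (k + 4 * s)
        regroup₂ = solve-∀

      finished : ∀ {x} → x ∈ seen cs′ → x ∈ seen cs ⊎ NbrClosed x (seen cs′)
      finished x∈ with Progress.finished progress x∈
      ... | inj₂ closed = inj₂ closed
      ... | inj₁ x∈f with covers x∈f
      ...   | inj₂ closed       = inj₂ closed
      ...   | inj₁ (here refl)  = inj₂ w-closed
      ...   | inj₁ (there x∈cs) = inj₁ x∈cs

      new : Progress 0 cs p cs′ (r ▷ back a)
      new = record
        { explored = explored-▷ (back a) (Progress.explored progress)
        ; seen-⊆   = Progress.seen-⊆ progress ∘ grow-⊇ f ∘ there
        ; cost≡    = trans (cong (λ x → cost c r + x + budget cs) heavy)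
            (pay {cost c p} {cost c q} {cost c r} {budget cs} (size f)
              (trans (Grown.cost≡ grown) (cong (λ x → cost c p + x + 2 * size f) heavy))
              (Progress.cost≡ progress))
        ; finished = finished }

    cross-correct : ∀ g {cs} (ms : List (Move v)) {p : Path s v} →
      Explored cs p → v ∈ seen cs → Enough g (seen cs) →
      wp (cross g cs ms) (Crossed cs ms p) p
    -- The inclusion of `grow f xs`, for some `xs`, records that the vertices of `f` are already
    -- seen; with `AllLight f` their tree edges cost 1 each way.
    visit-correct : ∀ g {cs} (f : Forest v) {xs} {p : Path s v} →
      Explored cs p → v ∈ seen cs → Enough g (seen cs) → AllLight f → grow f xs ⊆ seen cs →
      wp (visit g cs f) (Visited cs f p) p
    sweep-correct : ∀ g {cs} (f : Forest v) {xs} {p : Path s v} →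
      Explored cs p → Enough g (seen cs) → AllLight f → grow f xs ⊆ seen cs →
      wp (sweep g cs f) (Swept cs f p) p

    cross-correct zero ms explored v∈ enough =
      progress-refl explored , λ _ → outOfFuel (unique (Explored.found explored)) enough _
    cross-correct (suc g) [] explored v∈ enough = progress-refl explored , λ ()
    cross-correct (suc g) {cs} ((w , a) ∷ ms) {p} explored v∈ enough =
      wp-if (w ∈? seen cs)
      (λ w∈ → wp-map (cross (suc g) cs ms) (cross-correct (suc g) ms explored v∈ enough)
        λ cs′ q (progress , targets) → progress ,
          λ { (here refl) → Progress.seen-⊆ progress w∈ ; (there a∈) → targets a∈ })
      (λ w∉ →
        wp-bind (bind (lightForest g (w ∷ seen cs) _ (moves w)) λ f → visit g ((w , f) ∷ cs) f)
          (wp-bind (lightForest g (w ∷ seen cs) _ (moves w))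
            (lightForest-grown g (moves w) (found-new a w∉ (Explored.found explored))
              (enough-new {w = w} {xs = seen cs} enough))
            λ f q grown →
          wp-map (visit g ((w , f) ∷ cs) f)
            (visit-correct g f (explored-new explored w∉ grown) (grow-⊇ f (here refl))
              (enough-mono (unique {p = p ▷ a} (found-new a w∉ (Explored.found explored))) (grow-⊇ f)
                (enough-new {w = w} {xs = seen cs} enough))
              (Grown.light grown) id)
            -- The detour returns only the component list, so the postcondition keeps the forest and
            -- the path after the first pass as witnesses.
            λ cs′ r visited → f , q , grown , visited)
          λ cs′ r (f , q , grown , visited) →
        let progress = proj₁ (proj₁ visited)
            seen-⊆ : seen cs ⊆ seen cs′
            seen-⊆ = Progress.seen-⊆ progress ∘ grow-⊇ f ∘ there in
        wp-map (cross (suc g) cs′ ms)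
          (cross-correct (suc g) ms (explored-▷ (back a) (Progress.explored progress))
            (seen-⊆ v∈) (enough-explored {cs′ = cs′} explored seen-⊆ enough))
          λ cs″ r′ crossed → cross-new explored v∈ w∉ grown visited crossed)

    visit-correct {v} g {cs} f explored v∈ enough light f⊆ =
      wp-bind (cross g cs (moves v)) (cross-correct g (moves v) explored v∈ enough)
        λ cs′ q (progress , targets) →
      wp-map (sweep g cs′ f)
        (sweep-correct g f (Progress.explored progress)
          (enough-explored {cs′ = cs′} explored (Progress.seen-⊆ progress) enough) light
          (Progress.seen-⊆ progress ∘ f⊆))
        λ cs″ r (progress′ , covers) →
          (progress-trans progress progress′ , covers) ,
          λ y a → Progress.seen-⊆ progress′ (targets (∈-moves a))

    sweep-correct g [] explored enough light f⊆ = progress-refl explored , inj₁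
    sweep-correct g {cs} (branch {w = w} a f h) {xs} {p} explored enough (lightA , lightF , lightH) f⊆ =
      wp-bind (visit g cs f)
        (visit-correct g f (explored-▷ a explored) (f⊆ (grow-⊇ h (grow-⊇ f (here refl))))
          enough lightF (f⊆ ∘ grow-⊇ h))
        λ cs′ q ((progress , covers) , w-closed) →
      wp-map (sweep g cs′ h)
        (sweep-correct g h (explored-▷ (back a) (Progress.explored progress))
          (enough-explored {cs′ = cs′} explored (Progress.seen-⊆ progress) enough) lightH
          (Progress.seen-⊆ progress ∘ f⊆))
        λ cs″ r (progress′ , covers′) →
          -- The charge is 1 for each direction of the tree edge `a`, `2 * size f` below it and
          -- `2 * size h` for the remaining subtrees.
          subst (λ d → Progress d cs p cs″ r) (regroup (size f) (size h))
            (progress-trans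
              (progress-▷ (back a) lightA
                (progress-trans (progress-▷ a lightA (progress-refl explored)) progress))
              progress′) ,
          λ x∈ → covers-branch (Progress.seen-⊆ progress′) covers w-closed (covers′ x∈)
      where
      regroup : ∀ a b → suc (1 + 2 * a) + 2 * b ≡ 2 * suc (a + b)
      regroup = solve-∀
      covers-branch : ∀ {ys zs xs x} → ys ⊆ zs → Covers f ys → NbrClosed w ys →
                      x ∈ grow f (w ∷ xs) ⊎ NbrClosed x zs → x ∈ xs ⊎ NbrClosed x zs
      covers-branch ys⊆zs covers w-closed (inj₂ closed) = inj₂ closed
      covers-branch ys⊆zs covers w-closed (inj₁ x∈f) with covers x∈f
      ... | inj₂ closed      = inj₂ (nbrClosed-mono ys⊆zs closed)
      ... | inj₁ (here refl) = inj₂ (nbrClosed-mono ys⊆zs w-closed)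
      ... | inj₁ (there x∈)  = inj₁ x∈

    Complete : List Component → Path s s → Set
    Complete cs q = Explored cs q × s ∈ seen cs × (∀ {x} → x ∈ seen cs → NbrClosed x (seen cs)) ×
                    cost c q ≤ budget cs

    explore-correct : wp (explore (λ e _ → c e)) Complete []
    explore-correct =
      wp-bind (lightForest N (s ∷ []) _ (moves s))
        (lightForest-grown N (moves s) found₀ (n≤1+n N))
        λ f q grown →
      wp-map (visit N ((s , f) ∷ []) f)
        -- The component of `s` counts as new relative to an empty exploration.
        (visit-correct N f (explored-new nothingExplored (λ ()) grown) (grow-⊇ f (here refl))
          (enough-mono (unique found₀) (grow-⊇ f) (n≤1+n N))
          (Grown.light grown) id)
        λ { cs r ((progress , covers) , s-closed) →
          Progress.explored progress ,
          Progress.seen-⊆ progress (grow-⊇ f (here refl)) ,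
          (λ x∈ → [ (λ x∈f → [ (λ { (here refl) → s-closed }) , id ]′ (covers x∈f)) , id ]′
                    (Progress.finished progress x∈)) ,
          settle (size f) (Grown.cost≡ grown) (Progress.cost≡ progress) }
      where
      N : ℕ
      N = length (vertices {m} {n})
      found₀ : Found (s ∷ []) []
      found₀ = ([] ∷ []) , id
      nothingExplored : Explored [] []
      nothingExplored = record { found = [] , (λ ()) ; closed = λ () ; apart = [] }
      -- The first component is never crossed into, so its `2 * k` in the budget is slack and the
      -- equation weakens to an inequality.
      settle : ∀ {x y b} a → x ≡ 0 + 2 * a → y + (2 * k + 4 * a + 0) ≡ x + 2 * a + b → y ≤ b
      settle {y = y} {b} a refl eq = ≤-trans (m≤m+n y (2 * k))
        (≤-reflexive (+-cancelʳ-≡ (4 * a) _ _ (trans (regroup₁ y k a) (trans eq (regroup₂ a b)))))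
        where
        regroup₁ : ∀ y k a → y + 2 * k + 4 * a ≡ y + (2 * k + 4 * a + 0)
        regroup₁ = solve-∀
        regroup₂ : ∀ a b → 0 + 2 * a + 2 * a + b ≡ b + 4 * a
        regroup₂ = solve-∀

    -- Lower bound for every exploring path.

    -- k for each component and 1 for each light tree edge: up to the k of the
    -- first component, the weight of a minimum spanning tree.
    treeWeight : List Component → ℕ
    treeWeight []             = 0
    treeWeight ((r , f) ∷ cs) = k + size f + treeWeight cs

    -- The light tree edges account for the factor 4; the heavy part alone would need only 2.
    budget≤4*treeWeight : ∀ cs → budget cs ≤ 4 * treeWeight cs
    budget≤4*treeWeight [] = z≤n
    budget≤4*treeWeight ((r , f) ∷ cs) = begin
      2 * k + 4 * size f + budget cs
        ≤⟨ +-mono-≤ (+-monoˡ-≤ (4 * size f) (*-monoˡ-≤ k (s≤s (s≤s (z≤n {2})))))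
                    (budget≤4*treeWeight cs) ⟩
      4 * k + 4 * size f + 4 * treeWeight cs
        ≡⟨ regroup k (size f) (treeWeight cs) ⟩
      4 * (k + size f + treeWeight cs) ∎
      where
      open ≤-Reasoning
      regroup : ∀ k s w → 4 * k + 4 * s + 4 * w ≡ 4 * (k + s + w)
      regroup = solve-∀

    -- A tree has one vertex more than edges. So with N seen vertices and C components the weight is
    -- N - C + k C, with C moved to the other side.
    treeWeight-count : ∀ cs → treeWeight cs + length (roots cs) ≡ k * length (roots cs) + length (seen cs)
    treeWeight-count [] = sym (trans (+-identityʳ (k * 0)) (*-zeroʳ k))
    treeWeight-count ((r , f) ∷ cs) = begin
      k + size f + treeWeight cs + suc (length (roots cs))
        ≡⟨ regroup₁ k (size f) (treeWeight cs) (length (roots cs)) ⟩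
      k + size f + suc (treeWeight cs + length (roots cs))
        ≡⟨ cong (λ x → k + size f + suc x) (treeWeight-count cs) ⟩
      k + size f + suc (k * length (roots cs) + length (seen cs))
        ≡⟨ regroup₂ k (size f) (length (roots cs)) (length (seen cs)) ⟩
      k * suc (length (roots cs)) + (size f + suc (length (seen cs)))
        ≡⟨ cong (k * suc (length (roots cs)) +_) (sym (length-grow f (r ∷ seen cs))) ⟩
      k * suc (length (roots cs)) + length (grow f (r ∷ seen cs)) ∎
      where
      open ≡-Reasoning
      regroup₁ : ∀ k s w l → k + s + w + suc l ≡ k + s + suc (w + l)
      regroup₁ = solve-∀
      regroup₂ : ∀ k s l x → k + s + suc (k * l + x) ≡ k * suc l + (s + suc x)
      regroup₂ = solve-∀

    -- Both lists may overcount: a heavy step to a new vertex adds a representative even if its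
    -- light component already has one. The extra `k` in `bound` pays for the component of `s`.
    record Accounted (p : Path s v) : Set where
      field
        covering        : List V
        representatives : List V
        covers          : visited p ⊆ covering
        represents      : ∀ {x} → x ∈ visited p → Any (Connected x) representatives
        bound           : length covering + k * length representatives ≤
                          cost c p + k + length representatives

    endpoint-visited : (p : Path s v) → v ∈ visited p
    endpoint-visited []      = here refl
    endpoint-visited (p ▷ a) = here refl

    -- A step to a new vertex over a light edge pays 1 for the vertex, one over
    -- a heavy edge pays k for the vertex and for a possibly new light component.
    accounted : (p : Path s v) → Accounted p
    accounted [] = record
      { covering = s ∷ [] ; representatives = s ∷ [] ; covers = id
      ; represents = λ { (here refl) → here ε }
      ; bound = ≤-reflexive (regroup k) }
      where
      regroup : ∀ k → 1 + k * 1 ≡ 0 + k + 1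
      regroup = solve-∀
    accounted {v} (p ▷ a@(e , joins)) with v ∈? visited p
    ... | yes v∈ = record
      { covering = covering ; representatives = representatives
      ; covers = λ { (here refl) → covers v∈ ; (there x∈) → covers x∈ }
      ; represents = λ { (here refl) → represents v∈ ; (there x∈) → represents x∈ }
      ; bound = ≤-trans bound (+-monoˡ-≤ _ (+-monoˡ-≤ k (m≤m+n (cost c p) _))) }
      where open Accounted (accounted p)
    ... | no _ with proj₂ (c e)
    ...   | inj₁ light = record
      { covering = v ∷ covering ; representatives = representatives
      ; covers = λ { (here refl) → here refl ; (there x∈) → there (covers x∈) }
      -- The light edge joins `v` to the previous endpoint, so `v` shares the representative of that
      -- endpoint.
      ; represents = λ { (here refl) → Any.map ((e , swap joins , light) ◅_) (represents (endpoint-visited p))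
                       ; (there x∈)  → represents x∈ }
      ; bound = ≤-trans (s≤s bound) (≤-reflexive
          (trans (regroup (cost c p) k (length representatives))
                 (cong (λ x → cost c p + x + k + length representatives) (sym light)))) }
      where
      open Accounted (accounted p)
      regroup : ∀ x k l → suc (x + k + l) ≡ x + 1 + k + l
      regroup = solve-∀
    ...   | inj₂ heavy = record
      { covering = v ∷ covering ; representatives = v ∷ representatives
      ; covers = λ { (here refl) → here refl ; (there x∈) → there (covers x∈) }
      ; represents = λ { (here refl) → here ε ; (there x∈)  → there (represents x∈) }
      ; bound = begin
          suc (length covering) + k * suc (length representatives)
            ≡⟨ regroup₁ (length covering) k (length representatives) ⟩
          suc k + (length covering + k * length representatives)
            ≤⟨ +-monoʳ-≤ (suc k) bound ⟩
          suc k + (cost c p + k + length representatives)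
            ≡⟨ regroup₂ k (cost c p) (length representatives) ⟩
          cost c p + k + k + suc (length representatives)
            ≡⟨ cong (λ x → cost c p + x + k + suc (length representatives)) (sym heavy) ⟩
          cost c p + proj₁ (c e) + k + suc (length representatives) ∎ }
      where
      open Accounted (accounted p)
      open ≤-Reasoning
      regroup₁ : ∀ x k l → suc x + k * suc l ≡ suc k + (x + k * l)
      regroup₁ = solve-∀
      regroup₂ : ∀ k x l → suc k + (x + k + l) ≡ x + k + k + suc l
      regroup₂ = solve-∀

    -- The covering contains every seen vertex, and roots of distinct components cannot share a
    -- representative, as they would then be connected. For `k ≥ 1` the quantity N + (k - 1) C is
    -- monotone in both counts, so the overcounts of `Accounted` give an upper bound.
    treeWeight≤cost : 1 ≤ k → ∀ {cs} {q : Path s u} → Explored cs q →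
                      (p : Path s v) → Explores p → treeWeight cs ≤ cost c p + k
    treeWeight≤cost 1≤k {cs} explored p explores =
      compare 1≤k
        (unique-⊆⇒length≤ (unique (Explored.found explored)) (λ {x} _ → covers (explores x)))
        (pigeonhole {R = Connected}
          (AllPairs.map (λ ¬rr′ _ rl r′l → ¬rr′ (rl ◅◅ connected-sym r′l)) (Explored.apart explored))
          (All.tabulate λ {x} _ → represents (explores x)))
        bound (treeWeight-count cs)
      where
      open Accounted (accounted p)
      compare : ∀ {k w r t x l y} → 1 ≤ k → t ≤ x → r ≤ l →
                x + k * l ≤ y + k + l → w + r ≡ k * r + t → w ≤ y + k
      compare {suc j} {w} {r} {t} {x} {l} {y} (s≤s z≤n) t≤x r≤l bound eq = begin
        w         ≡⟨ +-cancelʳ-≡ r _ _ (trans eq (regroup₁ j r t)) ⟩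
        t + j * r ≤⟨ +-mono-≤ t≤x (*-monoʳ-≤ j r≤l) ⟩
        x + j * l ≤⟨ +-cancelʳ-≤ l _ _ (≤-trans (≤-reflexive (regroup₂ x j l)) bound) ⟩
        y + suc j ∎
        where
        open ≤-Reasoning
        regroup₁ : ∀ j r t → suc j * r + t ≡ t + j * r + r
        regroup₁ = solve-∀
        regroup₂ : ∀ x j l → x + j * l + l ≡ x + suc j * l
        regroup₂ = solve-∀

  -- From programs to online algorithms.

  module Replay {s t : V} (P : Reading s → Program A s t) where

    advance : Reading v → Program A u t → Maybe (Program A v t)
    advance l (return x) = nothing
    advance {v} l (go {v = w} a Q) with w ≟ᵛ v
    ... | yes refl = just (Q l)
    ... | no _     = nothing

    -- An online algorithm is given the path and the observed weights but no internal state, so the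
    -- state is recovered by replaying the program along the path. A path that departs from the
    -- program gives `nothing`.
    remaining : (p : Path s v) → Observation k p → Maybe (Program A v t)
    remaining []                 obs = just (P λ e i → obs e (s , here refl , i))
    remaining (_▷_ {v = v} p a) obs =
      remaining p (λ e (x , x∈ , i) → obs e (x , there x∈ , i)) >>=
      advance λ e i → obs e (v , here refl , i)

    nextMove : Maybe (Program A v t) → Maybe (Move v)
    nextMove (just (go {v = w} a Q)) = just (w , a)
    nextMove _                       = nothing

-- Existence of an optimal exploring path, and connectedness of grids.

module _ {k m n : ℕ} (1≤k : 1 ≤ k) (c : WeightFunction k m n) {s : Vertex m n} where

  steps : ∀ {v} → Path s v → ℕ
  steps []      = 0
  steps (p ▷ _) = suc (steps p)

  -- Every weight is at least 1. Hence a cost bound leaves only finitely many paths to search for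
  -- the optimum.
  steps≤cost : ∀ {v} (p : Path s v) → steps p ≤ cost c p
  steps≤cost []            = z≤n
  steps≤cost (p ▷ (e , _)) = begin
    suc (steps p)           ≡⟨ +-comm 1 (steps p) ⟩
    steps p + 1             ≤⟨ +-mono-≤ (steps≤cost p) (positive (proj₂ (c e))) ⟩
    cost c p + proj₁ (c e)  ∎
    where
    open ≤-Reasoning
    positive : ∀ {w} → w ≡ 1 ⊎ w ≡ k → 1 ≤ w
    positive (inj₁ refl) = ≤-refl
    positive (inj₂ refl) = 1≤k

  extensions : ∃ (Path s) → List (∃ (Path s))
  extensions (v , p) = map (λ (w , a) → w , p ▷ a) (moves v)

  paths : ℕ → List (∃ (Path s))
  paths zero    = (s , []) ∷ []
  paths (suc l) = concatMap extensions (paths l)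

  ∈-paths : ∀ {v} (p : Path s v) → (v , p) ∈ paths (steps p)
  ∈-paths []      = here refl
  ∈-paths (p ▷ a) = ∈-concatMap⁺ extensions (lose (∈-paths p) (∈-map⁺ _ (∈-moves a)))

  explores? : (p : ∃ (Path s)) → Dec (Explores (proj₂ p))
  explores? (v , p) = map′ (λ all w → All.lookup all (∈-vertices w)) (λ explores → All.tabulate λ {w} _ → explores w)
                           (All.all? (_∈? visited p) vertices)

  optimum : ∀ {v₀} (p₀ : Path s v₀) → Explores p₀ →
            ∃[ v ] Σ[ p ∈ Path s v ] (Explores p × (∀ {w} (q : Path s w) → Explores q → cost c p ≤ cost c q))
  optimum {v₀} p₀ explores₀ =
    proj₁ best , proj₂ best ,
    argmin-all value {P = Explores ∘ proj₂} explores₀ (All.all-filter explores? short) ,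
    minimal
    where
    value : ∃ (Path s) → ℕ
    value = cost c ∘ proj₂
    short candidates : List (∃ (Path s))
    -- `upTo` excludes its bound, so `suc` admits paths with exactly `cost c p₀` steps. Longer paths
    -- cost more than `p₀`, the default of `argmin`.
    short      = concatMap paths (upTo (suc (cost c p₀)))
    candidates = filter explores? short
    best : ∃ (Path s)
    best = argmin value (v₀ , p₀) candidates
    minimal : ∀ {w} (q : Path s w) → Explores q → value best ≤ cost c q
    minimal q explores with cost c q ≤? cost c p₀
    ... | yes q≤p₀ = All.lookup (f[argmin]≤f[xs] {f = value} (v₀ , p₀) candidates)
      (∈-filter⁺ explores?
        (∈-concatMap⁺ paths (lose (∈-upTo⁺ (s≤s (≤-trans (steps≤cost q) q≤p₀))) (∈-paths q)))
        explores)
    ... | no q≰p₀ = ≤-trans (f[argmin]≤f[⊤] {f = value} (v₀ , p₀) candidates) (<⇒≤ (≰⇒> q≰p₀))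

-- Every vertex is reached by following column `zero` to its row and then that row.
grid-connected : ∀ {m n} (P : Vertex (suc m) (suc n) → Set) → P (zero , zero) →
                 (∀ {u v} → P u → Adjacent u v → P v) → ∀ v → P v
grid-connected P P₀ step (i , j) =
  <-weakInduction (λ j → P (i , j))
    (<-weakInduction (λ i → P (i , zero)) P₀ (λ i Pi → step Pi (vertical i zero , inj₁ refl)) i)
    (λ j Pj → step Pj (horizontal i j , inj₁ refl)) j

-- The algorithm on ladders and its competitive ratio.

module _ (k : ℕ) where

  open Exploration k

  algorithm : OnlineAlgorithm k
  algorithm n p obs = nextMove (remaining p obs)
    where open Replay explore

  module _ {n} (c : LadderWeights k n) where

    open Correctness c s₀
    open Replay {s = s₀ {n}} explore

    -- The actual run agrees with the run described by `wp`: the invariant is that replaying the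
    -- path so far returns exactly the program still to be run.
    follow : ∀ {v} (P : Program (List Component) v s₀) {Q : List Component → LadderPath n s₀ → Set}
             {p : LadderPath n v} → Travels algorithm c p → remaining p (observe c p) ≡ just P → wp P Q p →
             ∃[ cs ] Σ[ q ∈ LadderPath n s₀ ]
               (Travels algorithm c q × algorithm n q (observe c q) ≡ nothing × Q cs q)
    follow (return cs) travels eq Qp = cs , _ , travels , cong nextMove eq , Qp
    follow (go {v = w} a P) {p = p} travels eq wpP =
      follow (P λ e _ → c e) (move travels (cong nextMove eq)) eq′ wpP
      where
      eq′ : remaining (p ▷ a) (observe c (p ▷ a)) ≡ just (P λ e _ → c e)
      eq′ rewrite eq | ≡-≟-identity _≟ᵛ_ {x = w} refl = refl

theorem3 : (k : ℕ) → 5 ≤ k → ∃[ alg ] Competitive {k} 4 alg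
-- The lower bound falls short of `treeWeight` by one `k`, for the component of the start; times 4
-- this is the additive constant.
theorem3 k 5≤k = algorithm k , 4 * k , λ n c →
  let open Exploration k
      open Correctness c (s₀ {n})
      cs , p , travels , stops , explored , s∈ , closed , cost≤ =
        follow k c (explore λ e _ → c e) {Complete} start refl explore-correct
      explores = λ v → Found.onPath (Explored.found explored)
                   (grid-connected (_∈ seen cs) s∈ (λ u∈ a → closed u∈ _ a) v)
      1≤k = ≤-trans (s≤s z≤n) 5≤k
      v , q , q-explores , q-minimal = optimum 1≤k c p explores
  in cost c p , cost c q , (s₀ , p , travels , stops , explores , refl) ,
     ((v , q , q-explores , refl) , q-minimal) ,
     (let open ≤-Reasoning in begin
       cost c p              ≤⟨ cost≤ ⟩
       budget cs             ≤⟨ budget≤4*treeWeight cs ⟩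
       4 * treeWeight cs     ≤⟨ *-monoʳ-≤ 4 (treeWeight≤cost 1≤k explored q q-explores) ⟩
       4 * (cost c q + k)    ≡⟨ *-distribˡ-+ 4 (cost c q) k ⟩
       4 * cost c q + 4 * k  ∎)
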